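{- A finite simple graph $G$ is matrogenic if and only if for every alternating 4-cycle $\langle a,b:c,d\rangle$ in $G$, the map $V(G)\to V(G)$ that exchanges $a$ and $c$, exchanges $b$ and $d$, and fixes every other vertex is an automorphism of $G$.
   Context: An alternating 4-cycle $\langle a,b:c,d\rangle$ in $G$ consists of four distinct vertices with $ab,cd\in E(G)$ and $bc,ad\notin E(G)$. A graph $G$ is matrogenic if the vertex sets of the alternating 4-cycles of $G$ form the set of circuits of a matroid on $V(G)$; it is known (Földes–Hammer) that equivalently, $G$ contains no alternating 4-cycle $\langle a,b:c,d\rangle$ together with a vertex $u\notin\{a,b,c,d\}$ that is adjacent to $a$ and not adjacent to $c$. -}

module Defs where

open import Data.Bool using (Bool; true; false; if_then_else_)
open import Data.Nat using (ℕ)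
open import Data.Fin using (Fin; _≟_)
open import Data.Fin.Subset using (Subset; ⁅_⁆; _∪_; _∈_; _⊆_; _-_) renaming (⊥ to ∅)
open import Data.Product using (Σ; ∃; _×_; _,_)
open import Relation.Binary.PropositionalEquality using (_≡_; _≢_)
open import Relation.Nullary using (¬_; does)
open import Function.Definitions using (Bijective)
open import Function.Bundles using (_⇔_)

record SimpleGraph (n : ℕ) : Set where
  field
    adj     : Fin n → Fin n → Bool
    symm    : ∀ x y → adj x y ≡ adj y x
    irrefl  : ∀ x → adj x x ≡ false

open SimpleGraph public

Edge : ∀ {n} → SimpleGraph n → Fin n → Fin n → Set
Edge G x y = adj G x y ≡ true

AltCycle : ∀ {n} → SimpleGraph n → Fin n → Fin n → Fin n → Fin n → Set
AltCycle G a b c d =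
  (a ≢ b × a ≢ c × a ≢ d × b ≢ c × b ≢ d × c ≢ d) ×
  Edge G a b × Edge G c d × ¬ Edge G b c × ¬ Edge G a d

quad : ∀ {n} → Fin n → Fin n → Fin n → Fin n → Subset n
quad a b c d = ⁅ a ⁆ ∪ (⁅ b ⁆ ∪ (⁅ c ⁆ ∪ ⁅ d ⁆))

IsAltCycleSet : ∀ {n} → SimpleGraph n → Subset n → Set
IsAltCycleSet G S = Σ _ λ a → Σ _ λ b → Σ _ λ c → Σ _ λ d →
  AltCycle G a b c d × S ≡ quad a b c d

-- A family 𝒞 of subsets of a finite ground set Fin n is the set of
-- circuits of a matroid (circuit axioms C1–C3).
IsCircuitFamily : ∀ {n} → (Subset n → Set) → Set
IsCircuitFamily {n} 𝒞 =
  ¬ 𝒞 ∅ ×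
  (∀ C₁ C₂ → 𝒞 C₁ → 𝒞 C₂ → C₁ ⊆ C₂ → C₁ ≡ C₂) ×
  (∀ C₁ C₂ e → 𝒞 C₁ → 𝒞 C₂ → C₁ ≢ C₂ → e ∈ C₁ → e ∈ C₂ →
     Σ (Subset n) λ C₃ → 𝒞 C₃ × C₃ ⊆ ((C₁ ∪ C₂) - e))

Matrogenic : ∀ {n} → SimpleGraph n → Set
Matrogenic G = IsCircuitFamily (IsAltCycleSet G)

swap4 : ∀ {n} → Fin n → Fin n → Fin n → Fin n → Fin n → Fin n
swap4 a b c d x =
  if does (x ≟ a) then c else
  if does (x ≟ c) then a else
  if does (x ≟ b) then d else
  if does (x ≟ d) then b else x

IsAutomorphism : ∀ {n} → SimpleGraph n → (Fin n → Fin n) → Set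
IsAutomorphism G σ =
  Bijective _≡_ _≡_ σ × (∀ x y → Edge G x y ⇔ Edge G (σ x) (σ y))

{-# OPTIONS --safe #-}
module Submission where

-- Both conditions are compared with the twin property: for every alternating
-- 4-cycle ⟨a,b:c,d⟩, each vertex outside it that is adjacent to a is adjacent
-- to c.  The symmetries of the cycle turn this into u ~ a ⇔ u ~ c and
-- u ~ b ⇔ u ~ d, which is what the exchange needs to be an automorphism.
--
-- If u ~ a but u ≁ c, then ⟨u,a:d,c⟩ is alternating too; eliminating a from the
-- two circuits forces b ~ u, whereas eliminating c forces b ≁ u.
--
-- Conversely, let ⟨a,b:c,d⟩ and ⟨a,f:g,h⟩ be distinct circuits through a.  If c
-- is not in the second one, its image under the exchange of the first avoids a
-- and stays in the union; symmetrically if g is not in the first one.  In the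
-- remaining cases the circuits share three vertices and an alternating 4-cycle
-- on the other four is written down.

open import Defs
open import Data.Bool using (true)
import Data.Bool.Properties as Bool
open import Data.Empty using (⊥; ⊥-elim)
open import Data.Fin using (Fin; zero; suc; _≟_)
open import Data.Fin.Subset using (Subset; inside; outside; ⁅_⁆; _∪_; _∈_; _∉_; _⊆_; _─_; _-_; ∣_∣) renaming (⊥ to ∅)
open import Data.Fin.Subset.Properties
open import Data.Nat using (ℕ; suc; _≤_; s≤s)
open import Data.Nat.Properties using (≤-trans; ≤-refl; ≤-reflexive; m≤n⇒m≤1+n; <⇒≱)
open import Data.Product using (∃-syntax; _×_; _,_; proj₁; proj₂)
open import Data.Sum using (_⊎_; inj₁; inj₂; [_,_]′)
open import Data.Vec using (_∷_; here; there)
open import Function using (_∘_)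
open import Function.Bundles using (_⇔_; mk⇔; Equivalence)
open import Function.Definitions using (Bijective)
open import Relation.Binary.PropositionalEquality using (_≡_; _≢_; refl; sym; trans; cong; subst; subst₂; ≢-sym)
open import Relation.Nullary using (Dec; ¬_; yes; no)
open import Relation.Nullary.Decidable using (dec-true; dec-false; decidable-stable)

private variable
  n : ℕ
  a b c d e f g h u x y z : Fin n
  p q S : Subset n

-- Finite subsets

x∈p─q⇒x∉q : (p q : Subset n) → x ∈ p ─ q → x ∉ q
x∈p─q⇒x∉q (_ ∷ _) (inside ∷ _)  ()        here
x∈p─q⇒x∉q (_ ∷ p) (_ ∷ q)       (there m) (there m′) = x∈p─q⇒x∉q p q m m′

x∈p-y⁻ : (p : Subset n) (y : Fin n) → x ∈ p - y → x ∈ p × x ≢ y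
x∈p-y⁻ p y m = p─q⊆p p ⁅ y ⁆ m , x∉⁅y⁆⇒x≢y (x∈p─q⇒x∉q p ⁅ y ⁆ m)

∣⁅x⁆∪p∣≤1+∣p∣ : (x : Fin n) (p : Subset n) → ∣ ⁅ x ⁆ ∪ p ∣ ≤ suc ∣ p ∣
∣⁅x⁆∪p∣≤1+∣p∣ zero    (inside  ∷ p) rewrite ∪-identityˡ p = m≤n⇒m≤1+n ≤-refl
∣⁅x⁆∪p∣≤1+∣p∣ zero    (outside ∷ p) rewrite ∪-identityˡ p = ≤-refl
∣⁅x⁆∪p∣≤1+∣p∣ (suc x) (inside  ∷ p) = s≤s (∣⁅x⁆∪p∣≤1+∣p∣ x p)
∣⁅x⁆∪p∣≤1+∣p∣ (suc x) (outside ∷ p) = ∣⁅x⁆∪p∣≤1+∣p∣ x p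

x∉p⇒∣p∣<∣⁅x⁆∪p∣ : x ∉ p → suc ∣ p ∣ ≤ ∣ ⁅ x ⁆ ∪ p ∣
x∉p⇒∣p∣<∣⁅x⁆∪p∣ {x = x} {p = p} x∉p =
  p⊂q⇒∣p∣<∣q∣ (q⊆p∪q ⁅ x ⁆ p , x , p⊆p∪q p (x∈⁅x⁆ x) , x∉p)

⊆∧∣∣≥⇒≡ : p ⊆ q → ∣ q ∣ ≤ ∣ p ∣ → p ≡ q
⊆∧∣∣≥⇒≡ {p = p} p⊆q ∣q∣≤∣p∣ = ⊆-antisym p⊆q λ {x} x∈q →
  decidable-stable (x ∈? p) λ x∉p →
    <⇒≱ (p⊂q⇒∣p∣<∣q∣ (p⊆q , x , x∈q , x∉p)) ∣q∣≤∣p∣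

-- Four-element sets

Distinct : (a b c d : Fin n) → Set
Distinct a b c d = a ≢ b × a ≢ c × a ≢ d × b ≢ c × b ≢ d × c ≢ d

∈₁ : a ∈ quad a b c d
∈₁ = p⊆p∪q _ (x∈⁅x⁆ _)

∈₂ : b ∈ quad a b c d
∈₂ = q⊆p∪q _ _ (p⊆p∪q _ (x∈⁅x⁆ _))

∈₃ : c ∈ quad a b c d
∈₃ = q⊆p∪q _ _ (q⊆p∪q _ _ (p⊆p∪q _ (x∈⁅x⁆ _)))

∈₄ : d ∈ quad a b c d
∈₄ = q⊆p∪q _ _ (q⊆p∪q _ _ (q⊆p∪q _ _ (x∈⁅x⁆ _)))

data OneOf (x a b c d : Fin n) : Set where
  is₁ : x ≡ a → OneOf x a b c d
  is₂ : x ≡ b → OneOf x a b c d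
  is₃ : x ≡ c → OneOf x a b c d
  is₄ : x ≡ d → OneOf x a b c d

quad⁻ : x ∈ quad a b c d → OneOf x a b c d
quad⁻ m with x∈p∪q⁻ _ _ m
... | inj₁ i = is₁ (x∈⁅y⁆⇒x≡y _ i)
... | inj₂ m with x∈p∪q⁻ _ _ m
... | inj₁ i = is₂ (x∈⁅y⁆⇒x≡y _ i)
... | inj₂ m with x∈p∪q⁻ _ _ m
... | inj₁ i = is₃ (x∈⁅y⁆⇒x≡y _ i)
... | inj₂ i = is₄ (x∈⁅y⁆⇒x≡y _ i)

quad-⊆ : a ∈ S → b ∈ S → c ∈ S → d ∈ S → quad a b c d ⊆ S
quad-⊆ a∈S b∈S c∈S d∈S m with quad⁻ m
... | is₁ refl = a∈S
... | is₂ refl = b∈S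
... | is₃ refl = c∈S
... | is₄ refl = d∈S

∉quad : x ≢ a → x ≢ b → x ≢ c → x ≢ d → x ∉ quad a b c d
∉quad x≢a x≢b x≢c x≢d m with quad⁻ m
... | is₁ eq = x≢a eq
... | is₂ eq = x≢b eq
... | is₃ eq = x≢c eq
... | is₄ eq = x≢d eq

∣quad∣≤4 : (a b c d : Fin n) → ∣ quad a b c d ∣ ≤ 4
∣quad∣≤4 a b c d =
  ≤-trans (∣⁅x⁆∪p∣≤1+∣p∣ a _) (s≤s (≤-trans (∣⁅x⁆∪p∣≤1+∣p∣ b _) (s≤s
    (≤-trans (∣⁅x⁆∪p∣≤1+∣p∣ c _) (s≤s (≤-reflexive (∣⁅x⁆∣≡1 d)))))))

4≤∣quad∣ : Distinct a b c d → 4 ≤ ∣ quad a b c d ∣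
4≤∣quad∣ {d = d} (a≢b , a≢c , a≢d , b≢c , b≢d , c≢d) =
  ≤-trans (s≤s (≤-trans (s≤s (≤-trans (s≤s (≤-reflexive (sym (∣⁅x⁆∣≡1 d))))
    (x∉p⇒∣p∣<∣⁅x⁆∪p∣ (x≢y⇒x∉⁅y⁆ c≢d))))
    (x∉p⇒∣p∣<∣⁅x⁆∪p∣ λ m → [ x≢y⇒x∉⁅y⁆ b≢c , x≢y⇒x∉⁅y⁆ b≢d ]′ (x∈p∪q⁻ _ _ m))))
    (x∉p⇒∣p∣<∣⁅x⁆∪p∣ λ m → [ x≢y⇒x∉⁅y⁆ a≢b ,
      (λ m → [ x≢y⇒x∉⁅y⁆ a≢c , x≢y⇒x∉⁅y⁆ a≢d ]′ (x∈p∪q⁻ _ _ m)) ]′ (x∈p∪q⁻ _ _ m))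

-- By counting: four distinct entries give at least four elements, and the right side has at most
-- four. Besides the antichain axiom, this identifies two listings of one circuit from a single
-- inclusion.
quad-⊆⇒≡ : Distinct a b c d → quad a b c d ⊆ quad e f g h → quad a b c d ≡ quad e f g h
quad-⊆⇒≡ {e = e} {f} {g} {h} dist sub =
  ⊆∧∣∣≥⇒≡ sub (≤-trans (∣quad∣≤4 e f g h) (4≤∣quad∣ dist))

-- Only `c` is left for `x`, so `y` and `z` share out `b` and `d`.
remaining-pair : Distinct a x y z → OneOf x a b c d → OneOf y a b c d → OneOf z a b c d →
  x ≢ b → x ≢ d → (y ≡ b × z ≡ d) ⊎ (y ≡ d × z ≡ b)
remaining-pair (a≢x , a≢y , a≢z , x≢y , x≢z , y≢z) ox oy oz x≢b x≢d = go ox oy oz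
  where
  go : _ → _ → _ → _
  go (is₁ refl) _          _          = ⊥-elim (a≢x refl)
  go (is₂ refl) _          _          = ⊥-elim (x≢b refl)
  go (is₄ refl) _          _          = ⊥-elim (x≢d refl)
  go (is₃ refl) (is₁ refl) _          = ⊥-elim (a≢y refl)
  go (is₃ refl) (is₃ refl) _          = ⊥-elim (x≢y refl)
  go (is₃ refl) _          (is₁ refl) = ⊥-elim (a≢z refl)
  go (is₃ refl) _          (is₃ refl) = ⊥-elim (x≢z refl)
  go (is₃ refl) (is₂ refl) (is₂ refl) = ⊥-elim (y≢z refl)
  go (is₃ refl) (is₂ refl) (is₄ refl) = inj₁ (refl , refl)
  go (is₃ refl) (is₄ refl) (is₂ refl) = inj₂ (refl , refl)
  go (is₃ refl) (is₄ refl) (is₄ refl) = ⊥-elim (y≢z refl)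

union⁻ : x ∈ quad a b c d ∪ quad u a d c → OneOf x a b c d ⊎ x ≡ u
union⁻ x∈ with x∈p∪q⁻ _ _ x∈
... | inj₁ m = inj₁ (quad⁻ m)
... | inj₂ m with quad⁻ m
...   | is₁ eq = inj₂ eq
...   | is₂ eq = inj₁ (is₁ eq)
...   | is₃ eq = inj₁ (is₄ eq)
...   | is₄ eq = inj₁ (is₃ eq)

-- The listing on the right is chosen for `altCycle-within⇒~`: the base vertex `c` comes first, and
-- the two vertices to be compared, `b` and `u`, take the second and fourth places. In `union-c⊆`
-- the base vertex is `a`.
union-a⊆ : (quad a b c d ∪ quad u a d c) - a ⊆ quad c b d u
union-a⊆ m with x∈ , x≢a ← x∈p-y⁻ _ _ m with union⁻ x∈
... | inj₁ (is₁ refl) = ⊥-elim (x≢a refl)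
... | inj₁ (is₂ refl) = ∈₂
... | inj₁ (is₃ refl) = ∈₁
... | inj₁ (is₄ refl) = ∈₃
... | inj₂ refl       = ∈₄

union-c⊆ : (quad a b c d ∪ quad u a d c) - c ⊆ quad a b d u
union-c⊆ m with x∈ , x≢c ← x∈p-y⁻ _ _ m with union⁻ x∈
... | inj₁ (is₁ refl) = ∈₁
... | inj₁ (is₂ refl) = ∈₂
... | inj₁ (is₃ refl) = ⊥-elim (x≢c refl)
... | inj₁ (is₄ refl) = ∈₃
... | inj₂ refl       = ∈₄

-- The exchange map

-- The graph of swap4, so that its values are read off by pattern matching.
data Exchange (a b c d : Fin n) : Fin n → Fin n → Set where
  a↦c : Exchange a b c d a c
  b↦d : Exchange a b c d b d
  c↦a : Exchange a b c d c a
  d↦b : Exchange a b c d d b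
  fix : x ∉ quad a b c d → Exchange a b c d x x

exchange-sym : Exchange a b c d x y → Exchange a b c d y x
exchange-sym a↦c      = c↦a
exchange-sym b↦d      = d↦b
exchange-sym c↦a      = a↦c
exchange-sym d↦b      = b↦d
exchange-sym (fix x∉) = fix x∉

-- `swap4` tests against `a`, `c`, `b`, `d` in this order; distinctness makes the earlier tests
-- fail.
exchange⇒swap4≡ : Distinct a b c d → Exchange a b c d x y → swap4 a b c d x ≡ y
exchange⇒swap4≡ {a = a} _ a↦c rewrite dec-true (a ≟ a) refl = refl
exchange⇒swap4≡ {b = b} (a≢b , _ , _ , b≢c , _) b↦d
  rewrite dec-false (b ≟ _) (≢-sym a≢b) | dec-false (b ≟ _) b≢c | dec-true (b ≟ b) refl = refl
exchange⇒swap4≡ {c = c} (_ , a≢c , _) c↦a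
  rewrite dec-false (c ≟ _) (≢-sym a≢c) | dec-true (c ≟ c) refl = refl
exchange⇒swap4≡ {d = d} (_ , _ , a≢d , _ , b≢d , c≢d) d↦b
  rewrite dec-false (d ≟ _) (≢-sym a≢d) | dec-false (d ≟ _) (≢-sym c≢d)
        | dec-false (d ≟ _) (≢-sym b≢d) | dec-true (d ≟ d) refl = refl
exchange⇒swap4≡ {a = a} {b} {c} {d} _ (fix {x} x∉)
  rewrite dec-false (x ≟ a) (λ { refl → x∉ ∈₁ }) | dec-false (x ≟ c) (λ { refl → x∉ ∈₃ })
        | dec-false (x ≟ b) (λ { refl → x∉ ∈₂ }) | dec-false (x ≟ d) (λ { refl → x∉ ∈₄ }) = refl

exchange-swap4 : Distinct a b c d → ∀ x → Exchange a b c d x (swap4 a b c d x)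
exchange-swap4 {a = a} {b} {c} {d} D x = via (exchange-total (x ∈? quad a b c d))
  where
  exchange-total : Dec (x ∈ quad a b c d) → ∃[ y ] Exchange a b c d x y
  exchange-total (no x∉) = x , fix x∉
  exchange-total (yes x∈) with quad⁻ x∈
  ... | is₁ refl = c , a↦c
  ... | is₂ refl = d , b↦d
  ... | is₃ refl = a , c↦a
  ... | is₄ refl = b , d↦b

  via : (∃[ y ] Exchange a b c d x y) → Exchange a b c d x (swap4 a b c d x)
  via (y , X) = subst (Exchange a b c d x) (sym (exchange⇒swap4≡ D X)) X

swap4-involutive : Distinct a b c d → ∀ x → swap4 a b c d (swap4 a b c d x) ≡ x
swap4-involutive D x = exchange⇒swap4≡ D (exchange-sym (exchange-swap4 D x))

involutive⇒bijective : {σ : Fin n → Fin n} → (∀ x → σ (σ x) ≡ x) → Bijective _≡_ _≡_ σ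
involutive⇒bijective {σ = σ} inv =
  (λ {x} {y} eq → trans (sym (inv x)) (trans (cong σ eq) (inv y))) ,
  (λ y → σ y , λ { refl → inv y })

-- A moved vertex lands in the quadruple, and a fixed one stays in `S`.
exchange-preserves-∪ : Exchange a b c d x y → x ∈ S → y ∈ quad a b c d ∪ S
exchange-preserves-∪ {S = S} a↦c _     = p⊆p∪q S ∈₃
exchange-preserves-∪ {S = S} b↦d _     = p⊆p∪q S ∈₄
exchange-preserves-∪ {S = S} c↦a _     = p⊆p∪q S ∈₁
exchange-preserves-∪ {S = S} d↦b _     = p⊆p∪q S ∈₂
exchange-preserves-∪ (fix _)     x∈S   = q⊆p∪q _ _ x∈S

-- Alternating 4-cycles and their symmetries

module _ {n : ℕ} (G : SimpleGraph n) where

  private variable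
    i j k l v w : Fin n

  _~_ _≁_ : Fin n → Fin n → Set
  x ~ y = Edge G x y
  x ≁ y = ¬ (x ~ y)

  ~-sym : v ~ w → w ~ v
  ~-sym {v} {w} vw = trans (symm G w v) vw

  ≁-sym : v ≁ w → w ≁ v
  ≁-sym v≁w = v≁w ∘ ~-sym

  ~⇒≢ : v ~ w → v ≢ w
  ~⇒≢ {v} vv refl with trans (sym vv) (irrefl G v)
  ... | ()

  separated : i ~ v → i ≁ w → v ≢ w
  separated iv i≁w refl = i≁w iv

  rotate : AltCycle G i j k l → AltCycle G k l i j
  rotate ((ij , ik , il , jk , jl , kl) , e₁ , e₂ , n₁ , n₂) =
    (kl , ≢-sym ik , ≢-sym jk , ≢-sym il , ≢-sym jl , ij) , e₂ , e₁ , ≁-sym n₂ , ≁-sym n₁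

  reflect : AltCycle G i j k l → AltCycle G j i l k
  reflect ((ij , ik , il , jk , jl , kl) , e₁ , e₂ , n₁ , n₂) =
    (≢-sym ij , jl , jk , il , ik , ≢-sym kl) , ~-sym e₁ , ~-sym e₂ , n₂ , n₁

  -- The symmetries `rotate` and `reflect` together carry any of the four places to the first.
  altCycle-through : IsAltCycleSet G S → v ∈ S →
    ∃[ j ] ∃[ k ] ∃[ l ] AltCycle G v j k l × S ≡ quad v j k l
  altCycle-through (i , j , k , l , A , refl) v∈ with quad⁻ v∈
  ... | is₁ refl = j , k , l , A , refl
  ... | is₂ refl = i , l , k , reflect A , quad-⊆⇒≡ (proj₁ A) (quad-⊆ ∈₂ ∈₁ ∈₄ ∈₃)
  ... | is₃ refl = l , i , j , rotate A , quad-⊆⇒≡ (proj₁ A) (quad-⊆ ∈₃ ∈₄ ∈₁ ∈₂)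
  ... | is₄ refl = k , j , i , reflect (rotate A) , quad-⊆⇒≡ (proj₁ A) (quad-⊆ ∈₄ ∈₃ ∈₂ ∈₁)

  altCycle-image : {σ : Fin n → Fin n} → IsAutomorphism G σ →
    AltCycle G i j k l → AltCycle G (σ i) (σ j) (σ k) (σ l)
  altCycle-image ((inj , _) , pres) ((ij , ik , il , jk , jl , kl) , e₁ , e₂ , n₁ , n₂) =
    (ij ∘ inj , ik ∘ inj , il ∘ inj , jk ∘ inj , jl ∘ inj , kl ∘ inj) ,
    to (pres _ _) e₁ , to (pres _ _) e₂ , n₁ ∘ from (pres _ _) , n₂ ∘ from (pres _ _)
    where open Equivalence

  TwinProperty : Set
  TwinProperty = ∀ {a b c d u} → AltCycle G a b c d → u ∉ quad a b c d → u ~ a → u ~ c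

  CircuitElimination : Set
  CircuitElimination = ∀ C₁ C₂ e → IsAltCycleSet G C₁ → IsAltCycleSet G C₂ → C₁ ≢ C₂ →
    e ∈ C₁ → e ∈ C₂ → ∃[ C₃ ] IsAltCycleSet G C₃ × C₃ ⊆ ((C₁ ∪ C₂) - e)

  Exchangeable : Set
  Exchangeable = ∀ a b c d → AltCycle G a b c d → IsAutomorphism G (swap4 a b c d)

  -- Twins and exchanges

  -- The exchange fixes `u` and sends `a` to `c`, so it carries the edge `ua` to `uc`.
  exchangeable⇒twins : Exchangeable → TwinProperty
  exchangeable⇒twins auto {a} {b} {c} {d} {u} A@(D , _) u∉ ua =
    subst₂ _~_ (exchange⇒swap4≡ D (fix u∉)) (exchange⇒swap4≡ D a↦c)
      (Equivalence.to (proj₂ (auto a b c d A) u a) ua)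

  module Twins (twins : TwinProperty) where

    ~a⇒~c : AltCycle G a b c d → u ∉ quad a b c d → u ~ a → u ~ c
    ~a⇒~c = twins

    ~c⇒~a : AltCycle G a b c d → u ∉ quad a b c d → u ~ c → u ~ a
    ~c⇒~a A u∉ = twins (rotate A) (u∉ ∘ quad-⊆ ∈₃ ∈₄ ∈₁ ∈₂)

    ~b⇒~d : AltCycle G a b c d → u ∉ quad a b c d → u ~ b → u ~ d
    ~b⇒~d A u∉ = twins (reflect A) (u∉ ∘ quad-⊆ ∈₂ ∈₁ ∈₄ ∈₃)

    ~d⇒~b : AltCycle G a b c d → u ∉ quad a b c d → u ~ d → u ~ b
    ~d⇒~b A u∉ = twins (reflect (rotate A)) (u∉ ∘ quad-⊆ ∈₄ ∈₃ ∈₂ ∈₁)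

    -- A pair with a fixed end is handled by the twin property. Inside the cycle, `ab` and `cd`
    -- trade places, as do the nonedges `bc` and `ad`, while `ac` and `bd` are merely reversed.
    exchange-preserves-~ : AltCycle G a b c d →
      Exchange a b c d v x → Exchange a b c d w y → v ~ w → x ~ y
    exchange-preserves-~ {a} {b} {c} {d} A@(D , ab , cd , b≁c , a≁d) = go
      where
      go-fix : u ∉ quad a b c d → Exchange a b c d w y → u ~ w → u ~ y
      go-fix u∉ a↦c     = ~a⇒~c A u∉
      go-fix u∉ b↦d     = ~b⇒~d A u∉
      go-fix u∉ c↦a     = ~c⇒~a A u∉
      go-fix u∉ d↦b     = ~d⇒~b A u∉
      go-fix u∉ (fix _) vw = vw

      go : Exchange a b c d v x → Exchange a b c d w y → v ~ w → x ~ y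
      go (fix v∉) Y        vw = go-fix v∉ Y vw
      go X        (fix w∉) vw = ~-sym (go-fix w∉ X (~-sym vw))
      go a↦c      a↦c      vw = ⊥-elim (~⇒≢ vw refl)
      go a↦c      b↦d      vw = cd
      go a↦c      c↦a      vw = ~-sym vw
      go a↦c      d↦b      vw = ⊥-elim (a≁d vw)
      go b↦d      a↦c      vw = ~-sym cd
      go b↦d      b↦d      vw = ⊥-elim (~⇒≢ vw refl)
      go b↦d      c↦a      vw = ⊥-elim (b≁c vw)
      go b↦d      d↦b      vw = ~-sym vw
      go c↦a      a↦c      vw = ~-sym vw
      go c↦a      b↦d      vw = ⊥-elim (b≁c (~-sym vw))
      go c↦a      c↦a      vw = ⊥-elim (~⇒≢ vw refl)
      go c↦a      d↦b      vw = ab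
      go d↦b      a↦c      vw = ⊥-elim (a≁d (~-sym vw))
      go d↦b      b↦d      vw = ~-sym vw
      go d↦b      c↦a      vw = ~-sym ab
      go d↦b      d↦b      vw = ⊥-elim (~⇒≢ vw refl)

  twins⇒exchangeable : TwinProperty → Exchangeable
  twins⇒exchangeable twins a b c d A@(D , _) =
    involutive⇒bijective (swap4-involutive D) ,
    -- The exchange is its own inverse, so the reverse implication is preservation applied to the
    -- images.
    λ x y → mk⇔ (preserves (X x) (X y)) (preserves (exchange-sym (X x)) (exchange-sym (X y)))
    where
    X = exchange-swap4 D
    preserves : Exchange a b c d v x → Exchange a b c d w y → v ~ w → x ~ y
    preserves = Twins.exchange-preserves-~ twins A

  -- Circuit elimination and twins

  -- A circuit has four elements, so it fills the quadruple; in particular it contains `i` and can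
  -- be listed from there.
  altCycle-within : IsAltCycleSet G S → S ⊆ quad i j k l →
    ∃[ x ] ∃[ y ] ∃[ z ] AltCycle G i x y z ×
      OneOf x i j k l × OneOf y i j k l × OneOf z i j k l
  altCycle-within C@(_ , _ , _ , _ , A , refl) S⊆
    with x , y , z , B , S≡ ← altCycle-through C
      (subst (_ ∈_) (sym (quad-⊆⇒≡ (proj₁ A) S⊆)) ∈₁) =
    x , y , z , B , within ∈₂ , within ∈₃ , within ∈₄
    where
    within : ∀ {v} → v ∈ quad _ x y z → OneOf v _ _ _ _
    within v∈ = quad⁻ (S⊆ (subst (_ ∈_) (sym S≡) v∈))

  -- The cycle has an edge at `i`, whose other end can only be `k`. The opposite edge of the cycle
  -- then joins `j` and `l`.
  altCycle-within⇒~ : IsAltCycleSet G S → S ⊆ quad i j k l → i ≁ j → i ≁ l → j ~ l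
  altCycle-within⇒~ C S⊆ i≁j i≁l
    with _ , _ , _ , (D , ix , yz , _) , ox , oy , oz ← altCycle-within C S⊆
    with remaining-pair D ox oy oz (separated ix i≁j) (separated ix i≁l)
  ... | inj₁ (refl , refl) = yz
  ... | inj₂ (refl , refl) = ~-sym yz

  -- Dually, the nonedge of the cycle at `i` must go to `k`, so the opposite nonedge is formed by
  -- `j` and `l`.
  altCycle-within⇒≁ : IsAltCycleSet G S → S ⊆ quad i j k l → i ~ j → i ~ l → j ≁ l
  altCycle-within⇒≁ C S⊆ ij il
    with _ , _ , _ , ((ix , iy , iz , xy , xz , yz) , _ , _ , x≁y , i≁z) , ox , oy , oz
           ← altCycle-within C S⊆
    with remaining-pair (iz , ix , iy , ≢-sym xz , ≢-sym yz , xy) oz ox oy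
           (≢-sym (separated ij i≁z)) (≢-sym (separated il i≁z))
  ... | inj₁ (refl , refl) = x≁y
  ... | inj₂ (refl , refl) = ≁-sym x≁y

  elimination⇒twins : CircuitElimination → TwinProperty
  elimination⇒twins eliminate {a} {b} {c} {d} {u}
    A@((_ , a≢c , a≢d , _ , _ , c≢d) , ab , cd , b≁c , a≁d) u∉ ua =
    decidable-stable (adj G u c Bool.≟ true) λ u≁c →
      let
        B : AltCycle G u a d c
        B = (~⇒≢ ua , (λ { refl → u∉ ∈₄ }) , (λ { refl → u∉ ∈₃ }) , a≢d , a≢c , ≢-sym c≢d)
          , ua , ~-sym cd , a≁d , u≁c
        eliminating : ∀ e → e ∈ quad a b c d → e ∈ quad u a d c → _
        eliminating e = eliminate _ _ e (_ , _ , _ , _ , A , refl) (_ , _ , _ , _ , B , refl)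
          (λ eq → u∉ (subst (u ∈_) (sym eq) ∈₁))
        _ , C , C⊆ = eliminating a ∈₁ ∈₂
        _ , C′ , C′⊆ = eliminating c ∈₃ ∈₄
      -- The circuit avoiding `a` lies on `b`, `c`, `d`, `u`, where `c` misses both `b` and `u`; the
      -- one avoiding `c` lies on `a`, `b`, `d`, `u`, where `a` meets both.
      in altCycle-within⇒≁ C′ (union-c⊆ ∘ C′⊆) ab (~-sym ua)
           (altCycle-within⇒~ C (union-a⊆ ∘ C⊆) (≁-sym b≁c) (≁-sym u≁c))

  -- Circuit elimination from exchanges

  exchange-avoids : Exchangeable → AltCycle G a b c d → AltCycle G e f g h →
    c ∉ quad e f g h →
    ∃[ C₃ ] IsAltCycleSet G C₃ × C₃ ⊆ ((quad a b c d ∪ quad e f g h) - a)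
  exchange-avoids {a} {b} {c} {d} {e} {f} {g} {h} auto A@(D , _) B c∉ =
    _ , (_ , _ , _ , _ , altCycle-image (auto a b c d A) B , refl) ,
    quad-⊆ (moved ∈₁) (moved ∈₂) (moved ∈₃) (moved ∈₄)
    where
    moved : x ∈ quad e f g h → swap4 a b c d x ∈ (quad a b c d ∪ quad e f g h) - a
    moved {x} x∈ = x∈p∧x≢y⇒x∈p-y (exchange-preserves-∪ (exchange-swap4 D x) x∈)
      -- By injectivity `c` is the only vertex sent to `a`.
      λ σx≡a → c∉ (subst (_∈ _)
        (proj₁ (proj₁ (auto a b c d A)) (trans σx≡a (sym (exchange⇒swap4≡ D c↦a)))) x∈)

  eliminate-first : Exchangeable → AltCycle G a b c d → AltCycle G a f g h →
    quad a b c d ≢ quad a f g h →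
    ∃[ C₃ ] IsAltCycleSet G C₃ × C₃ ⊆ ((quad a b c d ∪ quad a f g h) - a)
  eliminate-first {a} {b} {c} {d} {f} {g} {h} auto
    A@(D@(a≢b , a≢c , a≢d , b≢c , b≢d , c≢d) , ab , cd , b≁c , a≁d)
    B@(E@(a≢f , a≢g , a≢h , f≢g , f≢h , g≢h) , af , gh , f≁g , a≁h) A≢B
    with c ∈? quad a f g h | g ∈? quad a b c d
  ... | no c∉  | _      = exchange-avoids auto A B c∉
  ... | yes _  | no g∉
    with C₃ , 𝒞₃ , sub ← exchange-avoids auto B A g∉ =
    C₃ , 𝒞₃ , subst (λ U → C₃ ⊆ (U - a)) (∪-comm (quad a f g h) (quad a b c d)) sub
  ... | yes c∈ | yes g∈ = go (quad⁻ c∈) (quad⁻ g∈)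
    where
    open Twins (exchangeable⇒twins auto)

    differ : quad a b c d ⊆ quad a f g h → ⊥
    differ = A≢B ∘ quad-⊆⇒≡ D

    inˡ : x ∈ quad a b c d → a ≢ x → x ∈ (quad a b c d ∪ quad a f g h) - a
    inˡ x∈ a≢x = x∈p∧x≢y⇒x∈p-y (p⊆p∪q _ x∈) (≢-sym a≢x)

    inʳ : x ∈ quad a f g h → a ≢ x → x ∈ (quad a b c d ∪ quad a f g h) - a
    inʳ x∈ a≢x = x∈p∧x≢y⇒x∈p-y (q⊆p∪q _ _ x∈) (≢-sym a≢x)

    go : OneOf c a f g h → OneOf g a b c d →
      ∃[ C₃ ] IsAltCycleSet G C₃ × C₃ ⊆ ((quad a b c d ∪ quad a f g h) - a)
    go (is₁ refl) _ = ⊥-elim (a≢c refl)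
    go _ (is₁ refl) = ⊥-elim (a≢g refl)
    go (is₂ refl) (is₃ refl) = ⊥-elim (f≢g refl)
    -- The edge `cd` of the first circuit would be the nonedge `fg` of the second. The case `h = c`,
    -- `g = b` fails likewise: the edge `gh` would be the nonedge `bc`.
    go (is₂ refl) (is₄ refl) = ⊥-elim (f≁g cd)
    -- The circuits are ⟨a,b:c,d⟩ and ⟨a,c:b,h⟩.
    go (is₂ refl) (is₂ refl) =
      _ , (b , h , c , d , C , refl) ,
      quad-⊆ (inˡ ∈₂ a≢b) (inʳ ∈₄ a≢h) (inˡ ∈₃ a≢c) (inˡ ∈₄ a≢d)
      where
      h≢d : h ≢ d
      h≢d refl = differ (quad-⊆ ∈₁ ∈₃ ∈₂ ∈₄)
      h∉ : h ∉ quad a b c d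
      h∉ = ∉quad (≢-sym a≢h) (≢-sym g≢h) (≢-sym f≢h) h≢d
      d∉ : d ∉ quad a c b h
      d∉ = ∉quad (≢-sym a≢d) (≢-sym c≢d) (≢-sym b≢d) (≢-sym h≢d)
      -- For the nonedges: `h` misses `a`, hence also its twin `c` in the first circuit; `d` misses
      -- `a`, hence also its twin `b` in the second.
      C : AltCycle G b h c d
      C = (g≢h , b≢c , b≢d , ≢-sym f≢h , h≢d , c≢d) , gh , cd ,
          (≁-sym a≁h ∘ ~c⇒~a A h∉) , (≁-sym a≁d ∘ ~c⇒~a B d∉ ∘ ~-sym)
    -- f and h distinguish a from c, so both lie on the first circuit.
    go (is₃ refl) _ with f ∈? quad a b c d | h ∈? quad a b c d
    ... | no f∉ | _     = ⊥-elim (f≁g (~a⇒~c A f∉ (~-sym af)))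
    ... | _     | no h∉ = ⊥-elim (a≁h (~-sym (~c⇒~a A h∉ (~-sym gh))))
    ... | yes f∈ | yes h∈ = ⊥-elim (A≢B (sym (quad-⊆⇒≡ E (quad-⊆ ∈₁ f∈ ∈₃ h∈))))
    go (is₄ refl) (is₂ refl) = ⊥-elim (b≁c gh)
    go (is₄ refl) (is₃ refl) = ⊥-elim (g≢h refl)
    -- The circuits are ⟨a,b:c,d⟩ and ⟨a,f:d,c⟩.
    go (is₄ refl) (is₄ refl) =
      _ , (f , c , b , d , C , refl) ,
      quad-⊆ (inʳ ∈₂ a≢f) (inˡ ∈₃ a≢c) (inˡ ∈₂ a≢b) (inˡ ∈₄ a≢d)
      where
      f≢b : f ≢ b
      f≢b refl = differ (quad-⊆ ∈₁ ∈₂ ∈₄ ∈₃)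
      f∉ : f ∉ quad a b c d
      f∉ = ∉quad (≢-sym a≢f) f≢b f≢h f≢g
      b∉ : b ∉ quad a f d c
      b∉ = ∉quad (≢-sym a≢b) (≢-sym f≢b) b≢d b≢c
      -- For the edges: `f` meets `a`, hence also its twin `c` in the first circuit; `b` meets `a`,
      -- hence also its twin `d` in the second.
      C : AltCycle G f c b d
      C = (f≢h , f≢b , f≢g , ≢-sym b≢c , c≢d , b≢d) ,
          ~a⇒~c A f∉ (~-sym af) , ~a⇒~c B b∉ (~-sym ab) , ≁-sym b≁c , f≁g

  -- Both circuits are relisted so that the common vertex `e` comes first.
  exchangeable⇒elimination : Exchangeable → CircuitElimination
  exchangeable⇒elimination auto _ _ e 𝒞₁ 𝒞₂ C₁≢C₂ e∈C₁ e∈C₂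
    with _ , _ , _ , A , refl ← altCycle-through 𝒞₁ e∈C₁
       | _ , _ , _ , B , refl ← altCycle-through 𝒞₂ e∈C₂ = eliminate-first auto A B C₁≢C₂

  -- The other circuit axioms and the equivalence

  altCycleSet≢∅ : ¬ IsAltCycleSet G ∅
  altCycleSet≢∅ (_ , _ , _ , _ , _ , eq) = ∉⊥ (subst (_ ∈_) (sym eq) ∈₁)

  altCycleSet-antichain : ∀ C₁ C₂ → IsAltCycleSet G C₁ → IsAltCycleSet G C₂ → C₁ ⊆ C₂ → C₁ ≡ C₂
  altCycleSet-antichain _ _ (_ , _ , _ , _ , A , refl) (_ , _ , _ , _ , _ , refl) = quad-⊆⇒≡ (proj₁ A)

theorem3p3 : (n : ℕ) (G : SimpleGraph n) →
    Matrogenic G ⇔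
    (∀ a b c d → AltCycle G a b c d → IsAutomorphism G (swap4 a b c d))
theorem3p3 n G = mk⇔
  (λ { (_ , _ , eliminate) → twins⇒exchangeable G (elimination⇒twins G eliminate) })
  (λ auto → altCycleSet≢∅ G , altCycleSet-antichain G , exchangeable⇒elimination G auto)
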